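{- Let $d,k\in\mathbb N$, let $(U,\mathcal F)$ be an instance of \textsc{$d$-Hitting Set}, and let $(U',\mathcal F')$ be defined as in the context: $\mathcal F'$ is the family of inclusion-minimal good sets and $U'=\bigcup_{S\in\mathcal F'}S$. If $(U,\mathcal F)$ (and hence also $(U',\mathcal F')$) admits a hitting set of size at most $k$, then $$|U'|\le d\,|\mathcal F'| \quad\text{and}\quad |\mathcal F'|\le \left(1+\frac{2}{(k+1)(d-1)}\right)\cdot d!\,(k+1)^{d}.$$
   Context: An instance $(U,\mathcal F)$ of \textsc{$d$-Hitting Set} consists of a universe $U$ and a family $\mathcal F$ of subsets of $U$, each of cardinality exactly $d$; the parameter $k\in\mathbb N$ is the allowed size of a hitting set. A hitting set of a family of sets is a set of elements that intersects every set in the family. For $r\in\mathbb N$ let $\nu_r = r!\,(k+1)^r$. The notion of an "$(\ell,r)$-good" set is defined inductively, in decreasing order of $\ell$ from $d$ to $1$, and for fixed $\ell$, for increasing $r$ from $1$ to $d-\ell$: \begin{itemize} \item Any set $S\in\mathcal F$ is $(d,r)$-good for all $r$. \item A set $S\subseteq U$ is $\ell$-good if $S$ is $(\ell,r)$-good for some $r$. \item A set $S\subseteq U$ is $(\ell',r)$-strong if $S$ is $\ell'$-good and does not contain any $(\ell'-j,j)$-good subsets for any $j\in\{1,\dots,r-1\}$. \item A set $S\subseteq U$ is $(\ell,r)$-good if $S$ is of size $\ell$ and is contained in at least $\nu_r$ sets that are $(\ell+r,r)$-strong. \item A set $S\subseteq U$ is good if $S$ is $\ell$-good for $\ell=|S|$.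 \end{itemize} $\mathcal F'$ consists of those sets $S\subseteq U$ that are good and none of whose proper subsets are good; $U'$ consists of all $u\in U$ that are contained in some set of $\mathcal F'$.
   Formalization: The bound on |F'| is stated for d ≥ 2 only: for d = 1 the displayed fraction divides by zero, and for d = 0 (where F must be empty) it fails at k = 0; the other claims are proved for all d and k. -}

module Defs where

open import Data.Bool.Base using (true; false)
open import Data.Empty using (⊥)
open import Data.Fin.Base using (Fin)
open import Data.Fin.Subset using (Subset; inside; outside; _∈_; _⊆_; _⊂_; _∩_; ∣_∣; Nonempty)
open import Data.Fin.Subset.Properties using (_∈?_; _⊆?_; _⊂?_; anySubset?)
open import Data.Integer.Base using (+_)
open import Data.List.Base using (List; []; _∷_; [_]; _++_; map; filter; length)
open import Data.List.Membership.Propositional using () renaming (_∈_ to _∈ˡ_)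
open import Data.List.Membership.Propositional.Properties using (∈-++⁺ˡ; ∈-++⁺ʳ; ∈-map⁺; ∈-map⁻)
open import Data.List.Relation.Unary.All using ([]; _∷_)
open import Data.List.Relation.Unary.AllPairs using ([]; _∷_)
open import Data.List.Relation.Unary.Any using (here)
open import Data.List.Relation.Unary.Unique.Propositional using (Unique)
open import Data.List.Relation.Unary.Unique.Propositional.Properties using (++⁺; map⁺)
open import Data.Nat.Base
open import Data.Nat.Properties
open import Data.Product.Base using (∃; _×_; _,_)
open import Data.Rational.Base using (ℚ; 1ℚ) renaming (_/_ to _/ℚ_; _+_ to _+ℚ_; _*_ to _*ℚ_)
open import Data.Vec.Base using ([]; _∷_; tabulate)
open import Data.Vec.Properties using (∷-injectiveʳ; lookup∘tabulate; []=⇒lookup; lookup⇒[]=)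
open import Function.Bundles using (_⇔_; mk⇔)
open import Level using (0ℓ)
open import Relation.Binary.PropositionalEquality using (_≡_; refl; sym; trans; subst)
open import Relation.Nullary using (¬_; Dec; yes; no; does; contradiction)
open import Relation.Nullary.Decidable using (_×-dec_; _→-dec_; ¬?; dec-true; map′)
open import Relation.Unary using (Pred; Decidable)

subsets : ∀ n → List (Subset n)
subsets zero    = [ [] ]
subsets (suc n) = map (outside ∷_) (subsets n) ++ map (inside ∷_) (subsets n)

subsets-complete : ∀ {n} (S : Subset n) → S ∈ˡ subsets n
subsets-complete []          = here refl
subsets-complete (false ∷ S) = ∈-++⁺ˡ (∈-map⁺ _ (subsets-complete S))
subsets-complete (true  ∷ S) = ∈-++⁺ʳ _ (∈-map⁺ _ (subsets-complete S))

subsets-unique : ∀ n → Unique (subsets n)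
subsets-unique zero    = [] ∷ []
subsets-unique (suc n) =
  ++⁺ (map⁺ ∷-injectiveʳ (subsets-unique n)) (map⁺ ∷-injectiveʳ (subsets-unique n)) disjoint
  where
  disjoint : ∀ {S} → ¬ (S ∈ˡ map (outside ∷_) (subsets n) × S ∈ˡ map (inside ∷_) (subsets n))
  disjoint (p , q) with ∈-map⁻ _ p | ∈-map⁻ _ q
  ... | _ , _ , refl | _ , _ , ()

count : ∀ {n} {P : Pred (Subset n) 0ℓ} → Decidable P → ℕ
count {n} P? = length (filter P? (subsets n))

count-mono : ∀ {n} {P Q : Pred (Subset n) 0ℓ} (P? : Decidable P) (Q? : Decidable Q) →
             (∀ {S} → P S → Q S) → count P? ≤ count Q?
count-mono {n} P? Q? P⇒Q = go (subsets n)
  where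
  go : ∀ xs → length (filter P? xs) ≤ length (filter Q? xs)
  go []       = z≤n
  go (x ∷ xs) with P? x | Q? x
  ... | yes _ | yes _  = s≤s (go xs)
  ... | yes p | no  ¬q = contradiction (P⇒Q p) ¬q
  ... | no  _ | yes _  = m≤n⇒m≤1+n (go xs)
  ... | no  _ | no  _  = go xs

-- A family of subsets of the finite universe U = Fin n.
record Family (n : ℕ) : Set₁ where
  field
    Member  : Pred (Subset n) 0ℓ
    member? : Decidable Member

open Family public

∥_∥ : ∀ {n} → Family n → ℕ
∥ 𝓕 ∥ = count (member? 𝓕)

Uniform : ∀ {n} → ℕ → Family n → Set
Uniform d 𝓕 = ∀ {S} → Member 𝓕 S → ∣ S ∣ ≡ d

HittingSet : ∀ {n} → Family n → Subset n → Set
HittingSet 𝓕 H = ∀ {S} → Member 𝓕 S → Nonempty (H ∩ S)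

AdmitsHittingSet : ∀ {n} → ℕ → Subset n → Family n → Set
AdmitsHittingSet k U 𝓕 = ∃ λ H → H ⊆ U × HittingSet 𝓕 H × ∣ H ∣ ≤ k

module Kernel (d k : ℕ) {n : ℕ} (𝓕 : Family n) where

  ν : ℕ → ℕ
  ν r = r ! * suc k ^ r

  -- A candidate for the relation "S is (ℓ,r)-good".  The field `bounded` makes
  -- "(ℓ,r)-good for some r ∈ ℕ" decidable.
  record Goodness : Set₁ where
    field
      GoodAt  : ℕ → ℕ → Pred (Subset n) 0ℓ
      goodAt? : ∀ ℓ r → Decidable (GoodAt ℓ r)
      bounded : ∀ {ℓ r S} → GoodAt ℓ r S → ∃ λ r′ → r′ < suc d × GoodAt ℓ r′ S

    LevelGood : ℕ → Pred (Subset n) 0ℓ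
    LevelGood ℓ S = ∃ λ r → GoodAt ℓ r S

    Strong : ℕ → ℕ → Pred (Subset n) 0ℓ
    Strong ℓ r S = LevelGood ℓ S ×
      (∀ {j} → j < r → 1 ≤ j → ¬ (∃ λ T → T ⊆ S × GoodAt (ℓ ∸ j) j T))

    levelGood? : ∀ ℓ → Decidable (LevelGood ℓ)
    levelGood? ℓ S = map′ (λ (r , _ , g) → r , g) (λ (_ , g) → bounded g)
                          (anyUpTo? (λ r → goodAt? ℓ r S) (suc d))

    strong? : ∀ ℓ r → Decidable (Strong ℓ r)
    strong? ℓ r S = levelGood? ℓ S ×-dec
      allUpTo? (λ j → (1 ≤? j) →-dec
        ¬? (anySubset? (λ T → (T ⊆? S) ×-dec goodAt? (ℓ ∸ j) j T))) r

    -- The defining clauses of (ℓ,r)-goodness, with GoodAt standing for the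
    -- relation at levels above ℓ.
    data Clause : ℕ → ℕ → Pred (Subset n) 0ℓ where
      member : ∀ {r S} → Member 𝓕 S → Clause d r S
      many   : ∀ {ℓ r S} → 1 ≤ ℓ → 1 ≤ r → ℓ + r ≤ d → ∣ S ∣ ≡ ℓ →
               ν r ≤ count (λ T → (S ⊆? T) ×-dec strong? (ℓ + r) r T) →
               Clause ℓ r S

    clause? : ∀ ℓ r → Decidable (Clause ℓ r)
    clause? ℓ r S with (ℓ ≟ d) ×-dec member? 𝓕 S
    ... | yes (refl , S∈𝓕) = yes (member S∈𝓕)
    ... | no  ¬member with (1 ≤? ℓ) ×-dec (1 ≤? r) ×-dec (ℓ + r ≤? d) ×-dec (∣ S ∣ ≟ ℓ)
                           ×-dec (ν r ≤? count (λ T → (S ⊆? T) ×-dec strong? (ℓ + r) r T))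
    ...   | yes (a , b , c , e , f) = yes (many a b c e f)
    ...   | no  ¬many = no λ where
      (member S∈𝓕)     → ¬member (refl , S∈𝓕)
      (many a b c e f) → ¬many (a , b , c , e , f)

    clause-bounded : ∀ {ℓ r S} → Clause ℓ r S → ∃ λ r′ → r′ < suc d × Clause ℓ r′ S
    clause-bounded (member S∈𝓕) = 0 , z<s , member S∈𝓕
    clause-bounded {ℓ} {r} g@(many _ _ c _ _) = r , s≤s (≤-trans (m≤n+m r ℓ) c) , g

  open Goodness using (Clause; clause?; clause-bounded; member; many)

  goodness : ℕ → Goodness
  goodness zero = record
    { GoodAt = λ _ _ _ → ⊥ ; goodAt? = λ _ _ _ → no λ () ; bounded = λ () }
  goodness (suc f) = record
    { GoodAt  = Clause (goodness f)
    ; goodAt? = clause? (goodness f)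
    ; bounded = clause-bounded (goodness f) }

  -- The clauses at level ℓ consult only levels in ℓ+1, …, d, so suc d rounds
  -- reach the fixed point (see goodAt-unfold).
  open Goodness (goodness (suc d)) public using (GoodAt; goodAt?; LevelGood; levelGood?; Strong; strong?)

  Good : Pred (Subset n) 0ℓ
  Good S = LevelGood ∣ S ∣ S

  good? : Decidable Good
  good? S = levelGood? ∣ S ∣ S

  𝓕′ : Family n
  𝓕′ = record
    { Member  = λ S → Good S × ¬ (∃ λ T → T ⊂ S × Good T)
    ; member? = λ S → good? S ×-dec ¬? (anySubset? (λ T → (T ⊂? S) ×-dec good? T)) }

  covered? : Decidable (λ (u : Fin n) → ∃ λ S → Member 𝓕′ S × u ∈ S)
  covered? u = anySubset? (λ S → member? 𝓕′ S ×-dec (u ∈? S))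

  U′ : Subset n
  U′ = tabulate (λ u → does (covered? u))

  ∈U′⇔ : ∀ u → u ∈ U′ ⇔ (∃ λ S → Member 𝓕′ S × u ∈ S)
  ∈U′⇔ u = mk⇔ to from
    where
    to : u ∈ U′ → ∃ λ S → Member 𝓕′ S × u ∈ S
    to p with covered? u | trans (sym (lookup∘tabulate (λ v → does (covered? v)) u)) ([]=⇒lookup p)
    ... | yes c | _ = c
    ... | no  _ | ()

    from : (∃ λ S → Member 𝓕′ S × u ∈ S) → u ∈ U′
    from c = lookup⇒[]= u U′
      (trans (lookup∘tabulate (λ v → does (covered? v)) u) (dec-true (covered? u) c))

  private
    module _ (G H : Goodness) where
      private
        module G = Goodness G
        module H = Goodness H

      clause-transfer : ∀ {ℓ r S} →
        (∀ {m} → ℓ < m → ∀ {s T} → G.GoodAt m s T → H.GoodAt m s T) →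
        (∀ {m} → ℓ < m → ∀ {s T} → H.GoodAt m s T → G.GoodAt m s T) →
        G.Clause ℓ r S → H.Clause ℓ r S
      clause-transfer _ _ (member S∈𝓕) = member S∈𝓕
      clause-transfer {ℓ} {r} {S} to from (many a b c e f) =
        many a b c e (≤-trans f (count-mono
          (λ T → (S ⊆? T) ×-dec G.strong? (ℓ + r) r T)
          (λ T → (S ⊆? T) ×-dec H.strong? (ℓ + r) r T)
          (λ (S⊆T , (s , g) , none) → S⊆T , (s , to (m<m+n ℓ b) g) ,
            λ {j} j<r 1≤j (T′ , T′⊆T , h) →
              none j<r 1≤j (T′ , T′⊆T , from (above j<r) h))))
        where
        above : ∀ {j} → j < r → ℓ < ℓ + r ∸ j
        above {j} j<r = subst (ℓ <_) (sym (+-∸-assoc ℓ (<⇒≤ j<r))) (m<m+n ℓ (m<n⇒0<n∸m j<r))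

    clause-level : ∀ (G : Goodness) {ℓ r S} → Clause G ℓ r S → ℓ ≤ d
    clause-level G (member _)               = ≤-refl
    clause-level G {ℓ} {r} (many _ _ c _ _) = ≤-trans (m≤m+n ℓ r) c

    stable : ∀ f g {ℓ} → d < f + ℓ → d < g + ℓ → ∀ {r S} →
             Goodness.GoodAt (goodness f) ℓ r S → Goodness.GoodAt (goodness g) ℓ r S
    stable (suc f) zero    _ q c = contradiction (clause-level (goodness f) c) (<⇒≱ q)
    stable (suc f) (suc g) {ℓ} p q c =
      clause-transfer (goodness f) (goodness g)
        (λ ℓ<m → stable f g (raise f p ℓ<m) (raise g q ℓ<m))
        (λ ℓ<m → stable g f (raise g q ℓ<m) (raise f p ℓ<m)) c
      where
      raise : ∀ f {m} → d < suc f + ℓ → ℓ < m → d < f + m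
      raise f {m} d<f ℓ<m = ≤-trans (subst (d <_) (sym (+-suc f ℓ)) d<f) (+-monoʳ-≤ f ℓ<m)

  goodAt-unfold : ∀ {ℓ r S} → GoodAt ℓ r S ⇔ Clause (goodness (suc d)) ℓ r S
  goodAt-unfold {ℓ} = mk⇔ (stable (suc d) (suc (suc d)) p (m≤n⇒m≤1+n p))
                          (stable (suc (suc d)) (suc d) (m≤n⇒m≤1+n p) p)
    where
    p : d < suc d + ℓ
    p = m≤m+n (suc d) ℓ

-- (1 + 2 / ((k + 1)(d − 1))) · d! (k + 1)^d, defined for d ≥ 2.
sizeBound : (d k : ℕ) .{{_ : NonTrivial d}} → ℚ
sizeBound (2+ e) k =
  (1ℚ +ℚ (+ 2) /ℚ (suc k * (2+ e ∸ 1))) *ℚ ((+ ((2+ e) ! * suc k ^ 2+ e)) /ℚ 1)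

{-# OPTIONS --safe #-}

-- Let H be a hitting set with at most k elements.
--
-- H meets every good set: if it missed an (ℓ,r)-good S, each of the at least
-- ν r strong supersets T of S, being good at a higher level, would contain
-- S ∪ {h} for some h ∈ H.  For a fixed h at most ν (r − 1) of them do, for
-- otherwise S ∪ {h} would be an (ℓ+1,r−1)-good subset of a strong T (if r = 1,
-- then T = S ∪ {h} is determined by h).
-- But k · ν (r − 1) < ν r.
--
-- An inclusion-minimal good set is strong for every r, and it contains some
-- h ∈ H.  At most ν m minimal good sets of size m + 1 contain a fixed h, as
-- otherwise {h} would be (1,m)-good.  Hence |𝓕′| ≤ k · (ν 0 + … + ν (d − 1)),
-- which is at most ν d = d! (k + 1)^d, so the bound holds without the factor
-- 1 + 2 / ((k + 1)(d − 1)).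

module Submission where

open import Defs
open import Data.Fin.Base using (Fin; zero; suc)
open import Data.Fin.Subset using (∣_∣; ⊤; Subset; inside; outside; _∈_; _∉_; _⊆_; _⊂_; _∩_; _∪_; ⋃; ⁅_⁆; Nonempty)
open import Data.Fin.Subset.Properties
  using (_∈?_; _⊆?_; nonempty?; drop-∷-⊆; s⊂s; p⊂q⇒∣p∣<∣q∣; p⊆q⇒∣p∣≤∣q∣; x∈⁅y⁆⇒x≡y; ∣⁅x⁆∣≡1;
         ∣⊥∣≡0; ∪-identityʳ; x∈p∩q⁺; x∈p∩q⁻; x∈p∪q⁺; x∈p∪q⁻; p∩q⊆q; ∣p∩q∣≤∣p∣)
open import Data.Integer.Base using (+_; +≤+)
import Data.Integer.Properties as ℤ
open import Data.List.Base using (List; []; _∷_; filter; length)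
open import Data.List.Membership.Propositional using () renaming (_∈_ to _∈ˡ_)
open import Data.List.Membership.Propositional.Properties using (∈-filter⁺)
open import Data.List.Properties using (filter-none)
open import Data.List.Relation.Unary.All as All using (All; []; _∷_)
open import Data.List.Relation.Unary.All.Properties using (all-filter)
open import Data.List.Relation.Unary.AllPairs using ([]; _∷_)
open import Data.List.Relation.Unary.Any using (here; there)
open import Data.List.Relation.Unary.Unique.Propositional using (Unique)
open import Data.Nat.Base using (ℕ; _*_; _≤_; NonTrivial; zero; suc; 2+; _+_; _∸_; _^_; _!; _<_; z≤n; s≤s; z<s)
open import Data.Nat.Properties
open import Data.Product.Base using (_×_; ∃; _,_; proj₁; proj₂)
open import Data.Rational.Base using (_/_) renaming (_≤_ to _≤ℚ_)
open import Data.Rational.Base as ℚ using (1ℚ)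
import Data.Rational.Properties as ℚ
import Data.Rational.Unnormalised.Base as ℚᵘ
import Data.Rational.Unnormalised.Properties as ℚᵘ
open import Data.Sum.Base using (_⊎_; inj₁; inj₂)
open import Data.Vec.Base using ([]; _∷_; here; there)
open import Function.Base using (_∘_)
open import Function.Bundles using (Equivalence)
open import Level using (0ℓ)
open import Relation.Binary.PropositionalEquality using (_≡_; refl; sym; trans; cong; subst; subst₂)
open import Relation.Nullary using (¬_; yes; no; contradiction)
open import Relation.Nullary.Decidable using (_×-dec_; ¬?)
open import Relation.Unary using (Pred; Decidable)

private
  variable
    m n : ℕ
    P Q R : Pred (Subset n) 0ℓ

-- Inclusion, cardinality and unions of finite subsets.

⊆⇒≡⊎⊂ : {p q : Subset n} → p ⊆ q → p ≡ q ⊎ p ⊂ q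
⊆⇒≡⊎⊂ {p = []} {[]} _ = inj₁ refl
⊆⇒≡⊎⊂ {p = inside  ∷ p} {outside ∷ q} p⊆q with () ← p⊆q here
⊆⇒≡⊎⊂ {p = outside ∷ p} {inside  ∷ q} p⊆q = inj₂ (p⊆q , zero , here , λ ())
⊆⇒≡⊎⊂ {p = inside  ∷ p} {inside  ∷ q} p⊆q with ⊆⇒≡⊎⊂ (drop-∷-⊆ p⊆q)
... | inj₁ p≡q = inj₁ (cong (inside ∷_) p≡q)
... | inj₂ p⊂q = inj₂ (s⊂s p⊂q)
⊆⇒≡⊎⊂ {p = outside ∷ p} {outside ∷ q} p⊆q with ⊆⇒≡⊎⊂ (drop-∷-⊆ p⊆q)
... | inj₁ p≡q = inj₁ (cong (outside ∷_) p≡q)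
... | inj₂ p⊂q = inj₂ (s⊂s p⊂q)

⊆∧∣≡∣⇒≡ : {p q : Subset n} → p ⊆ q → ∣ p ∣ ≡ ∣ q ∣ → p ≡ q
⊆∧∣≡∣⇒≡ p⊆q ∣p∣≡∣q∣ with ⊆⇒≡⊎⊂ p⊆q
... | inj₁ p≡q = p≡q
... | inj₂ p⊂q = contradiction ∣p∣≡∣q∣ (<⇒≢ (p⊂q⇒∣p∣<∣q∣ p⊂q))

⊆∧∣<∣⇒⊂ : {p q : Subset n} → p ⊆ q → ∣ p ∣ < ∣ q ∣ → p ⊂ q
⊆∧∣<∣⇒⊂ p⊆q ∣p∣<∣q∣ with ⊆⇒≡⊎⊂ p⊆q
... | inj₁ refl = contradiction refl (<⇒≢ ∣p∣<∣q∣)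
... | inj₂ p⊂q  = p⊂q

x∈p⇒⁅x⁆⊆p : ∀ {x} {p : Subset n} → x ∈ p → ⁅ x ⁆ ⊆ p
x∈p⇒⁅x⁆⊆p {p = p} x∈p y∈⁅x⁆ = subst (_∈ p) (sym (x∈⁅y⁆⇒x≡y _ y∈⁅x⁆)) x∈p

∪-lub : {p q r : Subset n} → p ⊆ r → q ⊆ r → p ∪ q ⊆ r
∪-lub p⊆r q⊆r x∈p∪q with x∈p∪q⁻ _ _ x∈p∪q
... | inj₁ x∈p = p⊆r x∈p
... | inj₂ x∈q = q⊆r x∈q

x∉p⇒∣p∪⁅x⁆∣≡1+∣p∣ : ∀ {x} {p : Subset n} → x ∉ p → ∣ p ∪ ⁅ x ⁆ ∣ ≡ suc ∣ p ∣
x∉p⇒∣p∪⁅x⁆∣≡1+∣p∣ {x = zero}  {inside  ∷ p} x∉p = contradiction here x∉p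
x∉p⇒∣p∪⁅x⁆∣≡1+∣p∣ {x = zero}  {outside ∷ p} x∉p = cong (suc ∘ ∣_∣) (∪-identityʳ p)
x∉p⇒∣p∪⁅x⁆∣≡1+∣p∣ {x = suc x} {inside  ∷ p} x∉p = cong suc (x∉p⇒∣p∪⁅x⁆∣≡1+∣p∣ (x∉p ∘ there))
x∉p⇒∣p∪⁅x⁆∣≡1+∣p∣ {x = suc x} {outside ∷ p} x∉p = x∉p⇒∣p∪⁅x⁆∣≡1+∣p∣ (x∉p ∘ there)

∣p∪q∣≤∣p∣+∣q∣ : (p q : Subset n) → ∣ p ∪ q ∣ ≤ ∣ p ∣ + ∣ q ∣
∣p∪q∣≤∣p∣+∣q∣ []            []            = z≤n
∣p∪q∣≤∣p∣+∣q∣ (outside ∷ p) (outside ∷ q) = ∣p∪q∣≤∣p∣+∣q∣ p q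
∣p∪q∣≤∣p∣+∣q∣ (outside ∷ p) (inside  ∷ q) =
  ≤-trans (s≤s (∣p∪q∣≤∣p∣+∣q∣ p q)) (≤-reflexive (sym (+-suc ∣ p ∣ ∣ q ∣)))
∣p∪q∣≤∣p∣+∣q∣ (inside  ∷ p) (outside ∷ q) = s≤s (∣p∪q∣≤∣p∣+∣q∣ p q)
∣p∪q∣≤∣p∣+∣q∣ (inside  ∷ p) (inside  ∷ q) =
  s≤s (≤-trans (∣p∪q∣≤∣p∣+∣q∣ p q) (+-monoʳ-≤ ∣ p ∣ (n≤1+n ∣ q ∣)))

x∈⋃⁺ : ∀ {x p} {ps : List (Subset n)} → p ∈ˡ ps → x ∈ p → x ∈ ⋃ ps
x∈⋃⁺ (here refl) x∈p = x∈p∪q⁺ (inj₁ x∈p)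
x∈⋃⁺ (there p∈ps) x∈p = x∈p∪q⁺ (inj₂ (x∈⋃⁺ p∈ps x∈p))

∣⋃∣≤ : ∀ {c} {ps : List (Subset n)} → All (λ p → ∣ p ∣ ≤ c) ps → ∣ ⋃ ps ∣ ≤ length ps * c
∣⋃∣≤ {n}           []             = ≤-reflexive (∣⊥∣≡0 n)
∣⋃∣≤ {ps = p ∷ ps} (∣p∣≤c ∷ rest) =
  ≤-trans (∣p∪q∣≤∣p∣+∣q∣ p (⋃ ps)) (+-mono-≤ ∣p∣≤c (∣⋃∣≤ rest))

-- Upper bounds for the number of subsets with a given property.

count-empty : (P? : Decidable P) → (∀ {S} → ¬ P S) → count P? ≡ 0
count-empty {n} P? ¬P = cong length (filter-none P? (All.universal (λ _ → ¬P) (subsets n)))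

-- The enumeration has no repetitions, so once a set satisfying `P` is found, no later entry can
-- equal `X` again.
count-≤1 : (P? : Decidable P) (X : Subset n) → (∀ {S} → P S → X ≡ S) → count P? ≤ 1
count-≤1 {n} P? X P⇒≡ = go (subsets-unique n)
  where
  go : ∀ {xs} → Unique xs → length (filter P? xs) ≤ 1
  go [] = z≤n
  go {x ∷ xs} (x≢xs ∷ xs!) with P? x
  ... | no  _  = go xs!
  ... | yes Px = s≤s (≤-reflexive (cong length (filter-none P?
                   (All.map (λ x≢y Py → x≢y (trans (sym (P⇒≡ Px)) (P⇒≡ Py))) x≢xs))))

count-≤-+ : (P? : Decidable P) (Q? : Decidable Q) (R? : Decidable R) →
            (∀ {S} → P S → Q S ⊎ R S) → count P? ≤ count Q? + count R?
count-≤-+ {n} P? Q? R? P⇒Q⊎R = go (subsets n)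
  where
  go : ∀ xs → length (filter P? xs) ≤ length (filter Q? xs) + length (filter R? xs)
  go [] = z≤n
  go (x ∷ xs) with P? x | Q? x | R? x
  ... | no _  | no _  | no _  = go xs
  ... | no _  | yes _ | no _  = m≤n⇒m≤1+n (go xs)
  ... | no _  | no _  | yes _ = ≤-trans (go xs) (+-monoʳ-≤ _ (n≤1+n _))
  ... | no _  | yes _ | yes _ = m≤n⇒m≤1+n (≤-trans (go xs) (+-monoʳ-≤ _ (n≤1+n _)))
  ... | yes _ | yes _ | no _  = s≤s (go xs)
  ... | yes _ | yes _ | yes _ = s≤s (≤-trans (go xs) (+-monoʳ-≤ _ (n≤1+n _)))
  ... | yes _ | no _  | yes _ = ≤-trans (s≤s (go xs)) (≤-reflexive (sym (+-suc _ _)))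
  ... | yes p | no ¬q | no ¬r with P⇒Q⊎R p
  ...   | inj₁ q = contradiction q ¬q
  ...   | inj₂ r = contradiction r ¬r

-- A union bound over the elements of `H`, by induction on its characteristic vector.
count-≤-∣H∣* : ∀ {c} (H : Subset m) {Q : Fin m → Pred (Subset n) 0ℓ} →
               (P? : Decidable P) (Q? : ∀ h → Decidable (Q h)) →
               (∀ {S} → P S → ∃ λ h → h ∈ H × Q h S) →
               (∀ {h} → h ∈ H → count (Q? h) ≤ c) →
               count P? ≤ ∣ H ∣ * c
count-≤-∣H∣* [] P? Q? P⇒Q few =
  ≤-reflexive (count-empty P? λ p → contradiction (proj₁ (proj₂ (P⇒Q p))) λ ())
count-≤-∣H∣* {P = P} (outside ∷ H) {Q} P? Q? P⇒Q few =
  count-≤-∣H∣* H P? (Q? ∘ suc) shift (few ∘ there)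
  where
  shift : ∀ {S} → P S → ∃ λ h → h ∈ H × Q (suc h) S
  shift p with P⇒Q p
  ... | suc h , there h∈H , q = h , h∈H , q
count-≤-∣H∣* {P = P} (inside ∷ H) {Q} P? Q? P⇒Q few =
  ≤-trans (count-≤-+ P? (Q? zero) P∖Q₀? split)
          (+-mono-≤ (few here) (count-≤-∣H∣* H P∖Q₀? (Q? ∘ suc) shift (few ∘ there)))
  where
  -- Discarding the sets already charged to element `zero` forces the witness of every remaining set
  -- into the tail of `H`.
  P∖Q₀? : Decidable (λ S → P S × ¬ Q zero S)
  P∖Q₀? S = P? S ×-dec ¬? (Q? zero S)

  split : ∀ {S} → P S → Q zero S ⊎ (P S × ¬ Q zero S)
  split {S} p with Q? zero S
  ... | yes q = inj₁ q
  ... | no ¬q = inj₂ (p , ¬q)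

  shift : ∀ {S} → P S × ¬ Q zero S → ∃ λ h → h ∈ H × Q (suc h) S
  shift (p , ¬q) with P⇒Q p
  ... | zero  , _         , q = contradiction q ¬q
  ... | suc h , there h∈H , q = h , h∈H , q

-- Comparison with the rational bound.

/1-mono-≤ : m ≤ n → (+ m) / 1 ≤ℚ (+ n) / 1
/1-mono-≤ {m} {n} m≤n = ℚ.toℚᵘ-cancel-≤ (begin
  -- `_/_` normalises by a gcd; in the unnormalised rationals both denominators are literally 1.
  ℚ.toℚᵘ ((+ m) / 1)  ≃⟨ ℚ.toℚᵘ-fromℚᵘ (ℚᵘ.mkℚᵘ (+ m) 0) ⟩
  ℚᵘ.mkℚᵘ (+ m) 0     ≤⟨ ℚᵘ.*≤* (ℤ.*-monoʳ-≤-nonNeg (+ 1) (+≤+ m≤n)) ⟩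
  ℚᵘ.mkℚᵘ (+ n) 0     ≃⟨ ℚ.toℚᵘ-fromℚᵘ (ℚᵘ.mkℚᵘ (+ n) 0) ⟨
  ℚ.toℚᵘ ((+ n) / 1)  ∎)
  where open ℚᵘ.≤-Reasoning

d![1+k]^d≤sizeBound : ∀ d k .{{_ : NonTrivial d}} → (+ (d ! * suc k ^ d)) / 1 ≤ℚ sizeBound d k
d![1+k]^d≤sizeBound d@(2+ e) k = begin
  M                      ≡⟨ ℚ.*-identityˡ M ⟨
  1ℚ ℚ.* M               ≡⟨ cong (ℚ._* M) (ℚ.+-identityʳ 1ℚ) ⟨
  (1ℚ ℚ.+ ℚ.0ℚ) ℚ.* M    ≤⟨ ℚ.*-monoʳ-≤-nonNeg M (ℚ.+-monoʳ-≤ 1ℚ (ℚ.nonNegative⁻¹ ε)) ⟩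
  (1ℚ ℚ.+ ε) ℚ.* M       ∎
  where
  open ℚ.≤-Reasoning
  M = (+ (d ! * suc k ^ d)) / 1
  ε = (+ 2) / (suc k * (d ∸ 1))
  instance
    M≥0 : ℚ.NonNegative M
    M≥0 = ℚ.normalize-nonNeg (d ! * suc k ^ d) 1
    ε≥0 : ℚ.NonNegative ε
    ε≥0 = ℚ.normalize-nonNeg 2 (suc k * (d ∸ 1))

-- Good and strong sets of a uniform family.

module _ (d k : ℕ) {n : ℕ} (𝓕 : Family n) (uniform : Uniform d 𝓕) where

  open Kernel d k 𝓕
  open Goodness (goodness (suc d)) using (Clause; member; many)

  goodAt⇒clause : ∀ {ℓ r S} → GoodAt ℓ r S → Clause ℓ r S
  goodAt⇒clause = Equivalence.to goodAt-unfold

  ν>0 : ∀ r → 0 < ν r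
  ν>0 r = *-mono-≤ (1≤n! r) (m^n>0 (suc k) r)

  -- `ν (suc r)` equals `suc r * suc k * ν r`. This growth both gives the strict inequality behind
  -- `goodAt-hit` and absorbs the sum over cardinalities in `count-𝓕′-ofSize≤`.
  [1+k]*ν≤ν-suc : ∀ r → suc k * ν r ≤ ν (suc r)
  [1+k]*ν≤ν-suc r = begin
    suc k * (r ! * suc k ^ r)    ≡⟨ *-assoc (suc k) (r !) _ ⟨
    suc k * r ! * suc k ^ r      ≡⟨ cong (_* suc k ^ r) (*-comm (suc k) (r !)) ⟩
    r ! * suc k * suc k ^ r      ≡⟨ *-assoc (r !) (suc k) _ ⟩
    r ! * suc k ^ suc r          ≤⟨ *-monoˡ-≤ (suc k ^ suc r) (m≤n*m (r !) (suc r)) ⟩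
    suc r ! * suc k ^ suc r      ∎
    where open ≤-Reasoning

  goodAt-size : ∀ {ℓ r S} → GoodAt ℓ r S → ∣ S ∣ ≡ ℓ
  goodAt-size g with goodAt⇒clause g
  ... | member S∈𝓕         = uniform S∈𝓕
  ... | many _ _ _ ∣S∣≡ℓ _ = ∣S∣≡ℓ

  goodAt-level : ∀ {ℓ r S} → GoodAt ℓ r S → ℓ ≤ d
  goodAt-level g with goodAt⇒clause g
  ... | member _           = ≤-refl
  ... | many _ _ ℓ+r≤d _ _ = m+n≤o⇒m≤o _ ℓ+r≤d

  goodAt⇒good : ∀ {ℓ r S} → GoodAt ℓ r S → Good S
  goodAt⇒good {r = r} {S} g = r , subst (λ ℓ → GoodAt ℓ r S) (sym (goodAt-size g)) g

  strong-size : ∀ {ℓ r S} → Strong ℓ r S → ∣ S ∣ ≡ ℓ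
  strong-size ((_ , g) , _) = goodAt-size g

  -- For `r ≥ 1`, reaching `ν r` such supersets makes `X` itself good by the clause `many`.
  -- Non-goodness of `X` is assumed only in the presence of some `T` satisfying `P`, since callers
  -- derive it from such a `T`. The applications take `X` to be `S ∪ ⁅ h ⁆` and `⁅ h ⁆`.
  count-strong-supersets≤ν : ∀ r {X} {P : Pred (Subset n) 0ℓ} (P? : Decidable P) →
    1 ≤ ∣ X ∣ → ∣ X ∣ + r ≤ d →
    (∀ {T} → P T → X ⊆ T) →
    (∀ {T} → P T → Strong (∣ X ∣ + r) r T) →
    (∀ {T} → P T → 1 ≤ r → ¬ GoodAt ∣ X ∣ r X) →
    count P? ≤ ν r
  count-strong-supersets≤ν zero {X} P? _ _ ⊇X strong _ =
    -- For `r = 0` every `T` contains `X` and has the same size, so `T` is `X`, and `ν 0` is 1.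
    count-≤1 P? X λ p → ⊆∧∣≡∣⇒≡ (⊇X p) (sym (trans (strong-size (strong p)) (+-identityʳ _)))
  count-strong-supersets≤ν r@(suc _) {X} P? 1≤∣X∣ fits ⊇X strong notGood
    with goodAt? ∣ X ∣ r X | ≤-total (count P?) (ν r)
  -- If `X` is good, `notGood` refutes every `T`, so nothing is counted.
  ... | yes good | _        = ≤-trans (≤-reflexive (count-empty P? λ p → notGood p z<s good)) z≤n
  ... | no  _    | inj₁ few = few
  ... | no ¬good | inj₂ ν≤  = contradiction
    (Equivalence.from goodAt-unfold (many 1≤∣X∣ z<s fits refl
      (≤-trans ν≤ (count-mono P? (λ T → (X ⊆? T) ×-dec strong? (∣ X ∣ + r) r T)
                                 (λ p → ⊇X p , strong p)))))
    ¬good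

  𝓕′-size≤d : ∀ {S} → Member 𝓕′ S → ∣ S ∣ ≤ d
  𝓕′-size≤d ((_ , g) , _) = goodAt-level g

  -- `U′` lies in the union of the listed members of `𝓕′`, each of size at most `d`.
  ∣U′∣≤d*∥𝓕′∥ : ∣ U′ ∣ ≤ d * ∥ 𝓕′ ∥
  ∣U′∣≤d*∥𝓕′∥ = begin
    ∣ U′ ∣
      ≤⟨ p⊆q⇒∣p∣≤∣q∣ covered ⟩
    ∣ ⋃ (filter (member? 𝓕′) (subsets n)) ∣
      ≤⟨ ∣⋃∣≤ (All.map 𝓕′-size≤d (all-filter (member? 𝓕′) (subsets n))) ⟩
    ∥ 𝓕′ ∥ * d
      ≡⟨ *-comm ∥ 𝓕′ ∥ d ⟩
    d * ∥ 𝓕′ ∥ ∎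
    where
    open ≤-Reasoning

    covered : U′ ⊆ ⋃ (filter (member? 𝓕′) (subsets n))
    covered u∈U′ with Equivalence.to (∈U′⇔ _) u∈U′
    ... | S , S∈𝓕′ , u∈S = x∈⋃⁺ (∈-filter⁺ (member? 𝓕′) (subsets-complete S) S∈𝓕′) u∈S

  -- Consequences of a small hitting set.

  module _ {H : Subset n} (hitting : HittingSet 𝓕 H) (∣H∣≤k : ∣ H ∣ ≤ k) where

    -- The first argument is fuel for the descending induction on ℓ.
    goodAt-hit : ∀ f {ℓ r S} → d ≤ f + ℓ → GoodAt ℓ r S → Nonempty (H ∩ S)
    goodAt-hit f {ℓ} {r} {S} d≤f+ℓ g with goodAt⇒clause g
    goodAt-hit f d≤f+ℓ g | member S∈𝓕 = hitting S∈𝓕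
    -- Without fuel, `d ≤ ℓ` leaves no level above `ℓ` for strong supersets.
    goodAt-hit zero {ℓ} {suc r} d≤ℓ g | many _ _ ℓ+r≤d _ _ =
      contradiction (≤-trans ℓ+r≤d d≤ℓ) (<⇒≱ (m<m+n ℓ z<s))
    goodAt-hit (suc f) {ℓ} {suc r} {S} d≤f+ℓ g | many 1≤ℓ _ ℓ+r≤d refl ν≤ with nonempty? (H ∩ S)
    ... | yes hit  = hit
    ... | no  miss = contradiction ν≤ (<⇒≱ (begin-strict
      count (λ T → (S ⊆? T) ×-dec strong? (ℓ + suc r) (suc r) T)
                      ≤⟨ count-≤-∣H∣* H _ Through? hit few ⟩
      ∣ H ∣ * ν r     ≤⟨ *-monoˡ-≤ (ν r) ∣H∣≤k ⟩
      -- Strictness comes from the spare summand `ν r > 0`.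
      k * ν r         <⟨ m<n+m (k * ν r) (ν>0 r) ⟩
      suc k * ν r     ≤⟨ [1+k]*ν≤ν-suc r ⟩
      ν (suc r)       ∎))
      where
      open ≤-Reasoning

      Through : Fin n → Pred (Subset n) 0ℓ
      Through h T = h ∈ T × S ⊆ T × Strong (ℓ + suc r) (suc r) T

      Through? : ∀ h → Decidable (Through h)
      Through? h T = (h ∈? T) ×-dec (S ⊆? T) ×-dec strong? (ℓ + suc r) (suc r) T

      -- One unit of fuel is spent while the level rises by `suc r`, hence by at least one.
      above : d ≤ f + (ℓ + suc r)
      above = ≤-trans d≤f+ℓ (≤-trans (≤-reflexive (sym (+-suc f ℓ)))
                (+-monoʳ-≤ f (m<m+n ℓ z<s)))

      hit : ∀ {T} → S ⊆ T × Strong (ℓ + suc r) (suc r) T → ∃ λ h → h ∈ H × Through h T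
      hit (S⊆T , s@((_ , good) , _)) with goodAt-hit f above good
      ... | h , h∈H∩T with x∈p∩q⁻ H _ h∈H∩T
      ...   | h∈H , h∈T = h , h∈H , h∈T , S⊆T , s

      few : ∀ {h} → h ∈ H → count (Through? h) ≤ ν r
      -- Apply the bound to `X = S ∪ ⁅ h ⁆`, of size `suc ℓ` because `S` misses `H`; then
      -- `∣ X ∣ + r` is again the level `ℓ + suc r`.
      few {h} h∈H = count-strong-supersets≤ν r (Through? h)
        (subst (1 ≤_) (sym ∣X∣) z<s)
        (≤-trans (≤-reflexive ∣X∣+r) ℓ+r≤d)
        (λ (h∈T , S⊆T , _) → ∪-lub S⊆T (x∈p⇒⁅x⁆⊆p h∈T))
        (λ {T} (_ , _ , good , none) → subst (λ ℓ′ → Strong ℓ′ r T) (sym ∣X∣+r)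
          (good , λ j<r → none (m≤n⇒m≤1+n j<r)))
        -- Strength with parameter `suc r` excludes `j = r` as well, that is, `(suc ℓ, r)`-good
        -- subsets of `T`, and `X` would be one.
        (λ (h∈T , S⊆T , _ , none) 1≤r goodX → none ≤-refl 1≤r
          (S ∪ ⁅ h ⁆ , ∪-lub S⊆T (x∈p⇒⁅x⁆⊆p h∈T) ,
           subst (λ ℓ′ → GoodAt ℓ′ r (S ∪ ⁅ h ⁆)) ∣X∣≡ℓ+suc-r∸r goodX))
        where
        ∣X∣ : ∣ S ∪ ⁅ h ⁆ ∣ ≡ suc ℓ
        ∣X∣ = x∉p⇒∣p∪⁅x⁆∣≡1+∣p∣ λ h∈S → miss (h , x∈p∩q⁺ (h∈H , h∈S))

        ∣X∣+r : ∣ S ∪ ⁅ h ⁆ ∣ + r ≡ ℓ + suc r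
        ∣X∣+r = trans (cong (_+ r) ∣X∣) (sym (+-suc ℓ r))

        ∣X∣≡ℓ+suc-r∸r : ∣ S ∪ ⁅ h ⁆ ∣ ≡ ℓ + suc r ∸ r
        ∣X∣≡ℓ+suc-r∸r = trans (sym (m+n∸n≡m _ r)) (cong (_∸ r) ∣X∣+r)

    good-hit : ∀ {S} → Good S → Nonempty (H ∩ S)
    good-hit (_ , g) = goodAt-hit d (m≤m+n d _) g

    good-nonempty : ∀ {S} → Good S → 0 < ∣ S ∣
    good-nonempty {S} good with good-hit good
    ... | h , h∈H∩S = subst (_≤ ∣ S ∣) (∣⁅x⁆∣≡1 h)
                        (p⊆q⇒∣p∣≤∣q∣ (x∈p⇒⁅x⁆⊆p (proj₂ (x∈p∩q⁻ H S h∈H∩S))))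

    -- Every member of `𝓕′` lies inside `U′`, so cutting `H` down to `U′` loses no intersection.
    𝓕′-hit : AdmitsHittingSet k U′ 𝓕′
    𝓕′-hit = H ∩ U′ , p∩q⊆q H U′ , hit , ≤-trans (∣p∩q∣≤∣p∣ H U′) ∣H∣≤k
      where
      hit : HittingSet 𝓕′ (H ∩ U′)
      hit {S} S∈𝓕′ with good-hit (proj₁ S∈𝓕′)
      ... | h , h∈H∩S with x∈p∩q⁻ H S h∈H∩S
      ...   | h∈H , h∈S =
        h , x∈p∩q⁺ (x∈p∩q⁺ (h∈H , Equivalence.from (∈U′⇔ h) (S , S∈𝓕′ , h∈S)) , h∈S)

    -- Any subset forbidden by strength has size `∣ S ∣ ∸ j` with `j ≥ 1`, so it would be a proper
    -- good subset.
    minimal⇒strong : ∀ {S} r → Member 𝓕′ S → Strong ∣ S ∣ r S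
    minimal⇒strong {S} r (good , minimal) = good , λ {j} _ 1≤j (T , T⊆S , g) →
      minimal (T , ⊆∧∣<∣⇒⊂ T⊆S (subst (_< ∣ S ∣) (sym (goodAt-size g)) (smaller 1≤j)) , goodAt⇒good g)
      where
      -- Subtraction is truncated, so strictness rests on `S` being nonempty.
      smaller : ∀ {j} → 1 ≤ j → ∣ S ∣ ∸ j < ∣ S ∣
      smaller 1≤j = ≤-<-trans (∸-monoʳ-≤ ∣ S ∣ 1≤j) (∸-monoʳ-< z<s (good-nonempty good))

    -- Counting minimal good sets by cardinality.

    ofSize≤? : ∀ m → Decidable (λ S → Member 𝓕′ S × ∣ S ∣ ≤ m)
    ofSize≤? m S = member? 𝓕′ S ×-dec (∣ S ∣ ≤? m)

    ofSize? : ∀ m → Decidable (λ S → Member 𝓕′ S × ∣ S ∣ ≡ m)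
    ofSize? m S = member? 𝓕′ S ×-dec (∣ S ∣ ≟ m)

    -- Each such set is charged to an element `h` of `H` in it, and is a strong superset of `⁅ h ⁆`
    -- at level `1 + m`.
    count-𝓕′-ofSize : ∀ {m} → m < d → count (ofSize? (suc m)) ≤ k * ν m
    count-𝓕′-ofSize {m} m<d =
      ≤-trans (count-≤-∣H∣* H (ofSize? (suc m)) Through? hit (λ _ → few)) (*-monoˡ-≤ (ν m) ∣H∣≤k)
      where
      Through : Fin n → Pred (Subset n) 0ℓ
      Through h S = h ∈ S × Member 𝓕′ S × ∣ S ∣ ≡ suc m

      Through? : ∀ h → Decidable (Through h)
      Through? h S = (h ∈? S) ×-dec ofSize? (suc m) S

      hit : ∀ {S} → Member 𝓕′ S × ∣ S ∣ ≡ suc m → ∃ λ h → h ∈ H × Through h S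
      hit {S} p@((good , _) , _) with good-hit good
      ... | h , h∈H∩S with x∈p∩q⁻ H S h∈H∩S
      ...   | h∈H , h∈S = h , h∈H , h∈S , p

      few : ∀ {h} → count (Through? h) ≤ ν m
      few {h} = count-strong-supersets≤ν m (Through? h)
        (≤-reflexive (sym (∣⁅x⁆∣≡1 h)))
        (≤-trans (≤-reflexive ∣⁅h⁆∣+m) m<d)
        (λ (h∈S , _) → x∈p⇒⁅x⁆⊆p h∈S)
        (λ {S} (_ , S∈𝓕′ , ∣S∣) → subst (λ ℓ → Strong ℓ m S) (trans ∣S∣ (sym ∣⁅h⁆∣+m))
          (minimal⇒strong m S∈𝓕′))
        -- For `m ≥ 1` the singleton is a proper subset of `S`, so its goodness would contradict
        -- minimality.
        (λ (h∈S , (_ , minimal) , ∣S∣) 1≤m good → minimal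
          (⁅ h ⁆ , ⊆∧∣<∣⇒⊂ (x∈p⇒⁅x⁆⊆p h∈S) (subst₂ _<_ (sym (∣⁅x⁆∣≡1 h)) (sym ∣S∣) (s≤s 1≤m)) ,
           m , good))
        where
        ∣⁅h⁆∣+m : ∣ ⁅ h ⁆ ∣ + m ≡ suc m
        ∣⁅h⁆∣+m = cong (_+ m) (∣⁅x⁆∣≡1 h)

    -- The sum over cardinalities collapses inductively: `ν m + k * ν m` is `suc k * ν m` by
    -- definition, which is at most `ν (suc m)`. It starts at zero because good sets are nonempty.
    count-𝓕′-ofSize≤ : ∀ {m} → m ≤ d → count (ofSize≤? m) ≤ ν m
    count-𝓕′-ofSize≤ {zero} _ = ≤-trans (≤-reflexive (count-empty (ofSize≤? 0)
      λ (S∈𝓕′ , ∣S∣≤0) → <⇒≱ (good-nonempty (proj₁ S∈𝓕′)) ∣S∣≤0)) z≤n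
    count-𝓕′-ofSize≤ {suc m} m<d = begin
      count (ofSize≤? (suc m))
        ≤⟨ count-≤-+ (ofSize≤? (suc m)) (ofSize≤? m) (ofSize? (suc m)) split ⟩
      count (ofSize≤? m) + count (ofSize? (suc m))
        ≤⟨ +-mono-≤ (count-𝓕′-ofSize≤ (<⇒≤ m<d)) (count-𝓕′-ofSize m<d) ⟩
      suc k * ν m
        ≤⟨ [1+k]*ν≤ν-suc m ⟩
      ν (suc m) ∎
      where
      open ≤-Reasoning

      split : ∀ {S} → Member 𝓕′ S × ∣ S ∣ ≤ suc m →
              (Member 𝓕′ S × ∣ S ∣ ≤ m) ⊎ (Member 𝓕′ S × ∣ S ∣ ≡ suc m)
      split (S∈𝓕′ , ∣S∣≤) with m≤n⇒m<n∨m≡n ∣S∣≤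
      ... | inj₁ (s≤s ∣S∣≤m) = inj₁ (S∈𝓕′ , ∣S∣≤m)
      ... | inj₂ ∣S∣≡        = inj₂ (S∈𝓕′ , ∣S∣≡)

    ∥𝓕′∥≤ν : ∥ 𝓕′ ∥ ≤ ν d
    ∥𝓕′∥≤ν = ≤-trans
      (count-mono (member? 𝓕′) (ofSize≤? d) (λ S∈𝓕′ → S∈𝓕′ , 𝓕′-size≤d S∈𝓕′))
      (count-𝓕′-ofSize≤ ≤-refl)

lemma2 : ∀ (d k : ℕ) {n : ℕ} (𝓕 : Family n) →
    Uniform d 𝓕 →
    AdmitsHittingSet k ⊤ 𝓕 →
    let open Kernel d k 𝓕 in
    AdmitsHittingSet k U′ 𝓕′ ×
    ∣ U′ ∣ ≤ d * ∥ 𝓕′ ∥ ×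
    (.{{_ : NonTrivial d}} → (+ ∥ 𝓕′ ∥) / 1 ≤ℚ sizeBound d k)
lemma2 d k 𝓕 uniform (H , _ , hitting , ∣H∣≤k) =
  𝓕′-hit d k 𝓕 uniform hitting ∣H∣≤k ,
  ∣U′∣≤d*∥𝓕′∥ d k 𝓕 uniform ,
  ℚ.≤-trans (/1-mono-≤ (∥𝓕′∥≤ν d k 𝓕 uniform hitting ∣H∣≤k)) (d![1+k]^d≤sizeBound d k)
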